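{- For all integers $n\ge 0$, $\mathrm{cp}_{0,0,1}(n)$ is the sum of the perimeters of the partitions of $n$.
   Context: A partition of a non-negative integer $n$ is a finite multiset of positive integers (its parts) with sum $n$; the empty multiset is the unique partition of $0$. The perimeter of a nonempty partition is the size of its largest part plus its number of parts minus one; equivalently, the perimeter is the number of cells in the union of the first row and first column of its Young diagram. In particular the empty partition has perimeter $0$. A $(0,0,1)$-copartition is a triple $(\gamma,\rho,\sigma)$ where $\gamma$ and $\sigma$ are nonempty finite multisets of non-negative integers (so parts equal to $0$ are allowed, with multiplicity, and count as parts), and $\rho$ is the multiset having the same number of parts as $\sigma$, each of which has size equal to the number of parts of $\gamma$ (zero parts are included in both counts). Its size is $|\gamma|+|\rho|+|\sigma|$, where $|\cdot|$ denotes the sum of parts. $\mathrm{cp}_{0,0,1}(n)$ is the number of $(0,0,1)$-copartitions of size $n$. -}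

module Defs where

open import Data.List.Base
  using (List; []; _∷_; length; filter; upTo; cartesianProduct; cartesianProductWith)
open import Data.List.Extrema.Nat using (max)
open import Data.List.Membership.Propositional using (_∈_; _∉_)
open import Data.List.Membership.Propositional.Properties
  using (∈-upTo⁺; ∈-filter⁺; ∈-filter⁻; ∈-cartesianProduct⁺; ∈-cartesianProductWith⁺;
         ∈-cartesianProductWith⁻)
open import Data.List.Properties using (≡-dec; ∷-injective)
open import Data.List.Relation.Unary.All as All using (All; []; _∷_)
import Data.List.Relation.Unary.AllPairs as AllPairs
open import Data.List.Relation.Unary.Any using (here; there)
open import Data.List.Relation.Unary.Linked using (Linked; linked?)
open import Data.List.Relation.Unary.Unique.Propositional using (Unique)
import Data.List.Relation.Unary.Unique.Propositional.Properties as Unique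
open import Data.Nat.Base
  using (ℕ; zero; suc; _+_; _*_; _∸_; _≤_; _<_; _≥_; z≤n; s≤s)
open import Data.Nat.ListAction using (sum)
open import Data.Nat.Properties
  using (_≟_; _≥?_; _<?_; ≤-reflexive; ≤-trans; +-mono-≤; m≤m+n; m≤n+m;
         m≤m*n; m≤n*m)
open import Data.Product.Base using (_×_; _,_; proj₁; proj₂; uncurry)
open import Function.Bundles using (_⇔_; mk⇔)
open import Relation.Binary.PropositionalEquality
  using (_≡_; _≢_; refl; sym; cong; cong₂; subst)
open import Relation.Nullary.Decidable using (Dec; ¬?; map′; _×-dec_)
open import Relation.Nullary.Negation using (contradiction)

-- A finite multiset of naturals is represented by its unique weakly decreasing
-- listing, so that equality of multisets is propositional equality of lists.
IsMultiset : List ℕ → Set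
IsMultiset = Linked _≥_

record IsPartition (n : ℕ) (ps : List ℕ) : Set where
  constructor mkIsPartition
  field
    multiset : IsMultiset ps
    positive : All (0 <_) ps
    sum≡n    : sum ps ≡ n

perimeter : List ℕ → ℕ
perimeter []          = 0
perimeter ps@(_ ∷ _) = max 0 ps + length ps ∸ 1

Triple : Set
Triple = List ℕ × List ℕ × List ℕ

record IsCopartition (c : Triple) : Set where
  constructor mkIsCopartition
  γ = proj₁ c
  ρ = proj₁ (proj₂ c)
  σ = proj₂ (proj₂ c)
  field
    γ-multiset : IsMultiset γ
    ρ-multiset : IsMultiset ρ
    σ-multiset : IsMultiset σ
    γ-nonempty : γ ≢ []
    σ-nonempty : σ ≢ []
    ρ-length   : length ρ ≡ length σ
    ρ-parts    : All (_≡ length γ) ρ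

size : Triple → ℕ
size (γ , ρ , σ) = sum γ + sum ρ + sum σ

isPartition? : ∀ n ps → Dec (IsPartition n ps)
isPartition? n ps =
  map′ (λ (a , b , c) → mkIsPartition a b c)
       (λ (mkIsPartition a b c) → a , b , c)
       (linked? _≥?_ ps ×-dec All.all? (0 <?_) ps ×-dec (sum ps ≟ n))

isCopartition? : ∀ c → Dec (IsCopartition c)
isCopartition? (γ , ρ , σ) =
  map′ (λ (a , b , c , d , e , f , g) → mkIsCopartition a b c d e f g)
       (λ (mkIsCopartition a b c d e f g) → a , b , c , d , e , f , g)
       (linked? _≥?_ γ ×-dec linked? _≥?_ ρ ×-dec linked? _≥?_ σ
         ×-dec ¬? (≡-dec _≟_ γ []) ×-dec ¬? (≡-dec _≟_ σ [])
         ×-dec (length ρ ≟ length σ) ×-dec All.all? (_≟ length γ) ρ)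

-- All lists of length at most l with entries at most k.
boundedLists : ℕ → ℕ → List (List ℕ)
boundedLists k zero    = [] ∷ []
boundedLists k (suc l) = [] ∷ cartesianProductWith _∷_ (upTo (suc k)) (boundedLists k l)

boundedTriples : ℕ → List Triple
boundedTriples n = cartesianProduct ls (cartesianProduct ls ls)
  where ls = boundedLists n n

-- The bounds on the candidates lose nothing: see ∈-partitions and ∈-copartitions.
partitions : ℕ → List (List ℕ)
partitions n = filter (isPartition? n) (boundedLists n n)

copartitions : ℕ → List Triple
copartitions n = filter (λ c → isCopartition? c ×-dec (size c ≟ n)) (boundedTriples n)

cp₀₀₁ : ℕ → ℕ
cp₀₀₁ n = length (copartitions n)

boundedLists-unique : ∀ k l → Unique (boundedLists k l)
boundedLists-unique k zero    = [] AllPairs.∷ AllPairs.[]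
boundedLists-unique k (suc l) =
  All.tabulate (λ {ys} ys∈ []≡ys → []∉ (subst (_∈ _) (sym []≡ys) ys∈))
  AllPairs.∷
  Unique.cartesianProductWith⁺ _∷_ ∷-injective (Unique.upTo⁺ (suc k)) (boundedLists-unique k l)
  where
  []∉ : [] ∉ cartesianProductWith _∷_ (upTo (suc k)) (boundedLists k l)
  []∉ []∈ with ∈-cartesianProductWith⁻ _∷_ (upTo (suc k)) (boundedLists k l) []∈
  ... | _ , _ , _ , _ , ()

∈-boundedLists : ∀ {k} l {xs} → length xs ≤ l → All (_≤ k) xs → xs ∈ boundedLists k l
∈-boundedLists zero    {[]}    _         _            = here refl
∈-boundedLists (suc l) {[]}    _         _            = here refl
∈-boundedLists (suc l) {_ ∷ _} (s≤s len) (x≤k ∷ xs≤k) =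
  there (∈-cartesianProductWith⁺ _∷_ (∈-upTo⁺ (s≤s x≤k)) (∈-boundedLists l len xs≤k))

parts≤sum : ∀ xs → All (_≤ sum xs) xs
parts≤sum []       = []
parts≤sum (x ∷ xs) =
  m≤m+n x (sum xs) ∷ All.map (λ y≤ → ≤-trans y≤ (m≤n+m (sum xs) x)) (parts≤sum xs)

length≤sum : ∀ {xs} → All (0 <_) xs → length xs ≤ sum xs
length≤sum []         = z≤n
length≤sum (x>0 ∷ xs) = +-mono-≤ x>0 (length≤sum xs)

sum-const : ∀ {k xs} → All (_≡ k) xs → sum xs ≡ length xs * k
sum-const []         = refl
sum-const (x≡k ∷ xs) = cong₂ _+_ x≡k (sum-const xs)

∈-partitions : ∀ n ps → ps ∈ partitions n ⇔ IsPartition n ps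
∈-partitions n ps = mk⇔ (λ ps∈ → proj₂ (∈-filter⁻ (isPartition? n) {xs = boundedLists n n} ps∈)) complete
  where
  complete : ∀ {ps} → IsPartition n ps → ps ∈ partitions n
  complete {ps} p@(mkIsPartition _ pos refl) =
    ∈-filter⁺ (isPartition? n) (∈-boundedLists n (length≤sum pos) (parts≤sum ps)) p

partitions-unique : ∀ n → Unique (partitions n)
partitions-unique n = Unique.filter⁺ (isPartition? n) (boundedLists-unique n n)

bounded-triple : ∀ c → IsCopartition c → c ∈ boundedTriples (size c)
bounded-triple ([] , _ , _) p = contradiction refl (IsCopartition.γ-nonempty p)
bounded-triple (_ ∷ _ , _ , []) p = contradiction refl (IsCopartition.σ-nonempty p)
bounded-triple c@(γ@(_ ∷ _) , ρ , σ@(_ ∷ _)) p =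
  ∈-cartesianProduct⁺ (mem γ γ-len γ-sum)
    (∈-cartesianProduct⁺ (mem ρ (≤-trans (≤-reflexive ρ-length) σ-len) ρ-sum) (mem σ σ-len σ-sum))
  where
  open IsCopartition p using (ρ-length; ρ-parts)
  n = size c

  mem : ∀ xs → length xs ≤ n → sum xs ≤ n → xs ∈ boundedLists n n
  mem xs len s = ∈-boundedLists n len (All.map (λ x≤ → ≤-trans x≤ s) (parts≤sum xs))

  γ-sum : sum γ ≤ n
  γ-sum = ≤-trans (m≤m+n (sum γ) (sum ρ)) (m≤m+n _ (sum σ))

  ρ-sum : sum ρ ≤ n
  ρ-sum = ≤-trans (m≤n+m (sum ρ) (sum γ)) (m≤m+n _ (sum σ))

  σ-sum : sum σ ≤ n
  σ-sum = m≤n+m (sum σ) (sum γ + sum ρ)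

  area≤n : length σ * length γ ≤ n
  area≤n = subst (λ l → l * length γ ≤ n) ρ-length (subst (_≤ n) (sum-const ρ-parts) ρ-sum)

  γ-len : length γ ≤ n
  γ-len = ≤-trans (m≤n*m (length γ) (length σ)) area≤n

  σ-len : length σ ≤ n
  σ-len = ≤-trans (m≤m*n (length σ) (length γ)) area≤n

∈-copartitions : ∀ n c → c ∈ copartitions n ⇔ (IsCopartition c × size c ≡ n)
∈-copartitions n c =
  mk⇔ (λ c∈ → proj₂ (∈-filter⁻ P? {xs = boundedTriples n} c∈)) (uncurry complete)
  where
  P? = λ c → isCopartition? c ×-dec (size c ≟ n)
  complete : IsCopartition c → size c ≡ n → c ∈ copartitions n
  complete p eq = ∈-filter⁺ P? (subst (λ m → c ∈ boundedTriples m) eq (bounded-triple c p)) (p , eq)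

copartitions-unique : ∀ n → Unique (copartitions n)
copartitions-unique n = Unique.filter⁺ (λ c → isCopartition? c ×-dec (size c ≟ n))
  (Unique.cartesianProduct⁺ u (Unique.cartesianProduct⁺ u u))
  where u = boundedLists-unique n n

{-# OPTIONS --safe #-}
module Submission where

-- A copartition is a partition together with a cell of its rim.  Call a cell
-- of a Young diagram a rim cell when no cell lies diagonally below and to the
-- right of it.  The rim is a lattice path joining the end of the first row to
-- the end of the first column, so it has as many cells as the perimeter, and
-- the sum of the perimeters of the partitions of n counts the pairs formed by
-- a partition of n and one of its rim cells.
--
-- The cell in row k and column m is a rim cell exactly when the first k parts
-- are at least m and the others are at most m.  The diagram then consists of
-- the k by m rectangle with corner at that cell, a diagram with at most k rows
-- on its right, and a diagram with at most m columns below it.  The row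
-- lengths on the right, padded with zeros to k parts, form γ; the column
-- lengths below, padded with zeros to m parts, form σ; the rectangle is ρ.
-- This is undone by reading m off as the number of parts of σ.
--
-- The proof lists the rim cells of each partition (rimCells), shows that the
-- list has the right members (rimCells-sound, rimCells-complete) and the right
-- length (length-rimCells), and matches the concatenation of these lists with
-- the copartitions through the inverse maps toCopartition and fromCopartition.
-- Passing from rows to columns below the rectangle uses the inverse maps
-- columns and fromColumns.

open import Defs
open import Data.List.Base
  using (List; []; _∷_; _++_; length; map; concatMap; upTo; replicate)
open import Data.List.Extrema.Nat using (max; max≤v⁺; xs≤max)
open import Data.List.Membership.Propositional using (_∈_)
open import Data.List.Membership.Propositional.Properties
  using (∈-++⁺ˡ; ∈-++⁺ʳ; ∈-++⁻; ∈-map⁺; ∈-map⁻; ∈-upTo⁺; ∈-upTo⁻; ∈-concat⁺′; ∈-concat⁻′)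
open import Data.List.Membership.Propositional.Properties.WithK using (unique∧set⇒bag)
open import Data.List.Properties
  using (length-++; length-map; length-upTo; length-replicate; map-cong-local;
         map-∘; map-id)
open import Data.List.Relation.Binary.BagAndSetEquality using (∼bag⇒↭)
open import Data.List.Relation.Binary.Permutation.Propositional.Properties using (↭-length)
open import Data.List.Relation.Unary.All as All using (All; []; _∷_)
import Data.List.Relation.Unary.All.Properties as All
open import Data.List.Relation.Unary.AllPairs as AllPairs using (AllPairs; []; _∷_)
import Data.List.Relation.Unary.AllPairs.Properties as AllPairs
open import Data.List.Relation.Unary.Linked.Properties using (AllPairs⇒Linked; Linked⇒AllPairs)
open import Data.List.Relation.Unary.Unique.Propositional using (Unique)
import Data.List.Relation.Unary.Unique.Propositional.Properties as Unique
open import Data.Nat.Base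
  using (ℕ; zero; suc; _+_; _*_; _∸_; _≤_; _<_; _≥_; z≤n; s≤s; s≤s⁻¹)
open import Data.Nat.ListAction using (sum)
open import Data.Nat.ListAction.Properties using (sum-++)
open import Data.Nat.Properties
open import Data.Nat.Tactic.RingSolver using (solve-∀)
open import Data.Product.Base using (_×_; _,_; proj₁; proj₂)
open import Data.Sum.Base using (inj₁; inj₂)
open import Function.Base using (_∘_)
open import Function.Bundles using (_⇔_; mk⇔; Equivalence)
open import Relation.Binary.PropositionalEquality
open import Relation.Nullary.Negation using (contradiction)

-- Unlike IsMultiset, which compares neighbours only, this compares all pairs.
Decreasing : List ℕ → Set
Decreasing = AllPairs _≥_

Positive : List ℕ → Set
Positive = All (0 <_)

multiset⇒decreasing : ∀ {xs} → IsMultiset xs → Decreasing xs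
multiset⇒decreasing = Linked⇒AllPairs (λ x≥y y≥z → ≤-trans y≥z x≥y)

-- Row and column lengths

-- Adds to the diagram with row lengths μ a first column with s cells;
-- meaningful when μ has at most s rows.
addColumn : ℕ → List ℕ → List ℕ
addColumn zero    _       = []
addColumn (suc s) []      = 1 ∷ addColumn s []
addColumn (suc s) (x ∷ μ) = suc x ∷ addColumn s μ

-- Removes the first column, and with it the rows that become empty.
dropColumn : List ℕ → List ℕ
dropColumn []                = []
dropColumn (0 ∷ μ)           = dropColumn μ
dropColumn (1 ∷ μ)           = dropColumn μ
dropColumn (suc (suc x) ∷ μ) = suc x ∷ dropColumn μ

-- The lengths of the first m columns of the diagram with positive row
-- lengths μ; columns beyond the diagram have length 0.
columns : ℕ → List ℕ → List ℕ
columns zero    μ = []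
columns (suc m) μ = length μ ∷ columns m (dropColumn μ)

-- The row lengths of the diagram with the given decreasing column lengths;
-- columns of length 0 leave no trace.
fromColumns : List ℕ → List ℕ
fromColumns []      = []
fromColumns (s ∷ σ) = addColumn s (fromColumns σ)

length-addColumn : ∀ s μ → length (addColumn s μ) ≡ s
length-addColumn zero    μ       = refl
length-addColumn (suc s) []      = cong suc (length-addColumn s [])
length-addColumn (suc s) (x ∷ μ) = cong suc (length-addColumn s μ)

sum-addColumn : ∀ s μ → length μ ≤ s → sum (addColumn s μ) ≡ s + sum μ
sum-addColumn zero    []      _       = refl
sum-addColumn (suc s) []      _       = cong suc (sum-addColumn s [] z≤n)
sum-addColumn (suc s) (x ∷ μ) (s≤s l) = cong suc (trans
  (cong (x +_) (sum-addColumn s μ l))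
  (swap x s (sum μ)))
  where
  swap : ∀ a b c → a + (b + c) ≡ b + (a + c)
  swap = solve-∀

addColumn-positive : ∀ s μ → Positive (addColumn s μ)
addColumn-positive zero    μ       = []
addColumn-positive (suc s) []      = s≤s z≤n ∷ addColumn-positive s []
addColumn-positive (suc s) (x ∷ μ) = s≤s z≤n ∷ addColumn-positive s μ

addColumn-bounded : ∀ {b} s {μ} → All (_≤ b) μ → All (_≤ suc b) (addColumn s μ)
addColumn-bounded zero    _        = []
addColumn-bounded (suc s) []       = s≤s z≤n ∷ addColumn-bounded s []
addColumn-bounded (suc s) (p ∷ ps) = s≤s p ∷ addColumn-bounded s ps

addColumn-decreasing : ∀ s {μ} → Decreasing μ → Decreasing (addColumn s μ)
addColumn-decreasing zero    _        = []
addColumn-decreasing (suc s) []       = addColumn-bounded s [] ∷ addColumn-decreasing s []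
addColumn-decreasing (suc s) (p ∷ ps) = addColumn-bounded s p ∷ addColumn-decreasing s ps

dropColumn-positive : ∀ μ → Positive (dropColumn μ)
dropColumn-positive []                = []
dropColumn-positive (0 ∷ μ)           = dropColumn-positive μ
dropColumn-positive (1 ∷ μ)           = dropColumn-positive μ
dropColumn-positive (suc (suc x) ∷ μ) = s≤s z≤n ∷ dropColumn-positive μ

dropColumn-bounded : ∀ {b μ} → All (_≤ suc b) μ → All (_≤ b) (dropColumn μ)
dropColumn-bounded []                                 = []
dropColumn-bounded {μ = 0 ∷ _}           (_ ∷ ps)     = dropColumn-bounded ps
dropColumn-bounded {μ = 1 ∷ _}           (_ ∷ ps)     = dropColumn-bounded ps
dropColumn-bounded {μ = suc (suc _) ∷ _} (s≤s p ∷ ps) = p ∷ dropColumn-bounded ps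

dropColumn-decreasing : ∀ {μ} → Decreasing μ → Decreasing (dropColumn μ)
dropColumn-decreasing []                         = []
dropColumn-decreasing {0 ∷ _}           (_ ∷ ps) = dropColumn-decreasing ps
dropColumn-decreasing {1 ∷ _}           (_ ∷ ps) = dropColumn-decreasing ps
dropColumn-decreasing {suc (suc _) ∷ _} (p ∷ ps) = dropColumn-bounded p ∷ dropColumn-decreasing ps

length-dropColumn : ∀ μ → length (dropColumn μ) ≤ length μ
length-dropColumn []                = z≤n
length-dropColumn (0 ∷ μ)           = m≤n⇒m≤1+n (length-dropColumn μ)
length-dropColumn (1 ∷ μ)           = m≤n⇒m≤1+n (length-dropColumn μ)
length-dropColumn (suc (suc x) ∷ μ) = s≤s (length-dropColumn μ)

bounded-by-0 : ∀ {μ} → Positive μ → All (_≤ 0) μ → μ ≡ []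
bounded-by-0 []      _        = refl
bounded-by-0 (p ∷ _) (q ∷ _) = contradiction q (<⇒≱ p)

dropColumn-addColumn : ∀ s {μ} → Positive μ → length μ ≤ s → dropColumn (addColumn s μ) ≡ μ
dropColumn-addColumn zero    []           _       = refl
dropColumn-addColumn (suc s) []           _       = dropColumn-addColumn s [] z≤n
dropColumn-addColumn (suc s) (s≤s _ ∷ ps) (s≤s l) = cong (_ ∷_) (dropColumn-addColumn s ps l)

addColumn-dropColumn : ∀ {μ} → Positive μ → Decreasing μ →
                       addColumn (length μ) (dropColumn μ) ≡ μ
addColumn-dropColumn [] [] = refl
addColumn-dropColumn {1 ∷ μ} (_ ∷ ps) (q ∷ qs)
  -- The rows after a row of length 1 have length 1 too.
  with dropColumn μ | bounded-by-0 (dropColumn-positive μ) (dropColumn-bounded q)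
     | addColumn-dropColumn ps qs
... | _ | refl | ih = cong (1 ∷_) ih
addColumn-dropColumn {suc (suc x) ∷ μ} (_ ∷ ps) (_ ∷ qs) =
  cong (suc (suc x) ∷_) (addColumn-dropColumn ps qs)

length-columns : ∀ m μ → length (columns m μ) ≡ m
length-columns zero    μ = refl
length-columns (suc m) μ = cong suc (length-columns m (dropColumn μ))

columns-bounded : ∀ {b} m μ → length μ ≤ b → All (_≤ b) (columns m μ)
columns-bounded zero    μ l = []
columns-bounded (suc m) μ l = l ∷ columns-bounded m _ (≤-trans (length-dropColumn μ) l)

columns-decreasing : ∀ m μ → Decreasing (columns m μ)
columns-decreasing zero    μ = []
columns-decreasing (suc m) μ =
  columns-bounded m _ (length-dropColumn μ) ∷ columns-decreasing m (dropColumn μ)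

fromColumns-columns : ∀ m {μ} → Positive μ → Decreasing μ → All (_≤ m) μ →
                      fromColumns (columns m μ) ≡ μ
fromColumns-columns zero    pos dec bdd = sym (bounded-by-0 pos bdd)
fromColumns-columns (suc m) {μ} pos dec bdd = trans
  (cong (addColumn (length μ))
    (fromColumns-columns m (dropColumn-positive μ) (dropColumn-decreasing dec)
      (dropColumn-bounded bdd)))
  (addColumn-dropColumn pos dec)

fromColumns-positive : ∀ σ → Positive (fromColumns σ)
fromColumns-positive []      = []
fromColumns-positive (s ∷ σ) = addColumn-positive s (fromColumns σ)

fromColumns-decreasing : ∀ σ → Decreasing (fromColumns σ)
fromColumns-decreasing []      = []
fromColumns-decreasing (s ∷ σ) = addColumn-decreasing s (fromColumns-decreasing σ)

fromColumns-bounded : ∀ σ → All (_≤ length σ) (fromColumns σ)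
fromColumns-bounded []      = []
fromColumns-bounded (s ∷ σ) = addColumn-bounded s (fromColumns-bounded σ)

-- The first column is the longest.
length-fromColumns : ∀ {b σ} → All (_≤ b) σ → length (fromColumns σ) ≤ b
length-fromColumns []                = z≤n
length-fromColumns {σ = s ∷ σ} (p ∷ _) =
  subst (_≤ _) (sym (length-addColumn s (fromColumns σ))) p

sum-fromColumns : ∀ {σ} → Decreasing σ → sum (fromColumns σ) ≡ sum σ
sum-fromColumns []                  = refl
sum-fromColumns {s ∷ σ} (p ∷ ps) = trans
  (sum-addColumn s (fromColumns σ) (length-fromColumns p))
  (cong (s +_) (sum-fromColumns ps))

columns-fromColumns : ∀ {σ} → Decreasing σ → columns (length σ) (fromColumns σ) ≡ σ
columns-fromColumns []               = refl
columns-fromColumns {s ∷ σ} (p ∷ ps) = cong₂ _∷_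
  (length-addColumn s (fromColumns σ))
  (trans
    (cong (columns (length σ))
      (dropColumn-addColumn s (fromColumns-positive σ) (length-fromColumns p)))
    (columns-fromColumns ps))

sum-columns : ∀ m {μ} → Positive μ → Decreasing μ → All (_≤ m) μ → sum (columns m μ) ≡ sum μ
sum-columns m {μ} pos dec bdd = trans
  (sym (sum-fromColumns (columns-decreasing m μ)))
  (cong sum (fromColumns-columns m pos dec bdd))

-- Rim cells

-- A cell of a diagram: the rows down to that of the cell, the rows below it,
-- and the column of the cell, counted from 1.
Cell : Set
Cell = List ℕ × List ℕ × ℕ

-- The cell is a rim cell of the diagram with decreasing row lengths ps: no-diag
-- says that the rows below end before the next column.
record IsRimCell (ps : List ℕ) (c : Cell) : Set where
  constructor mkIsRimCell
  upper  = proj₁ c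
  lower  = proj₁ (proj₂ c)
  column = proj₂ (proj₂ c)
  field
    rows     : upper ++ lower ≡ ps
    nonempty : upper ≢ []
    column>0 : 0 < column
    inside   : All (column ≤_) upper
    no-diag  : All (_≤ column) lower

-- The first column with a rim cell in a row that is followed by the rows xs,
-- which are positive: a cell further to the left has a cell diagonally below
-- it.
firstColumn : List ℕ → ℕ
firstColumn []      = 1
firstColumn (y ∷ _) = y

-- The rim cells in the first row of the diagram with rows x ∷ xs.
topCells : ℕ → List ℕ → List Cell
topCells x xs = map (λ i → x ∷ [] , xs , firstColumn xs + i) (upTo (suc x ∸ firstColumn xs))

-- The same cell after a row of length x is put on top of the diagram.
pushRow : ℕ → Cell → Cell
pushRow x (α , β , m) = x ∷ α , β , m

-- The rim cells of a diagram with positive, decreasing row lengths.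
rimCells : List ℕ → List Cell
rimCells []       = []
rimCells (x ∷ xs) = topCells x xs ++ map (pushRow x) (rimCells xs)

length-topCells : ∀ x xs → length (topCells x xs) ≡ suc x ∸ firstColumn xs
length-topCells x xs =
  trans (length-map _ (upTo n)) (length-upTo n)
  where n = suc x ∸ firstColumn xs

-- The last row contributes as many rim cells as its length, and every other
-- row one more than its excess over the next row, so the sum telescopes.
length-rimCells-∷ : ∀ {x xs} → Decreasing (x ∷ xs) →
                    length (rimCells (x ∷ xs)) ≡ x + length xs
length-rimCells-∷ {x} {xs} (p ∷ ps) = trans (length-++ (topCells x xs)) (trans
  (cong₂ _+_ (length-topCells x xs) (length-map (pushRow x) (rimCells xs)))
  (rest p ps))
  where
  rest : ∀ {xs} → All (_≤ x) xs → Decreasing xs →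
         (suc x ∸ firstColumn xs) + length (rimCells xs) ≡ x + length xs
  rest []              []             = refl
  rest {y ∷ ys} (y≤x ∷ _) ps = begin
    (suc x ∸ y) + length (rimCells (y ∷ ys)) ≡⟨ cong ((suc x ∸ y) +_) (length-rimCells-∷ ps) ⟩
    (suc x ∸ y) + (y + length ys)            ≡⟨ +-assoc (suc x ∸ y) y (length ys) ⟨
    (suc x ∸ y) + y + length ys              ≡⟨ cong (_+ length ys) (m∸n+n≡m (m≤n⇒m≤1+n y≤x)) ⟩
    suc x + length ys                        ≡⟨ +-suc x (length ys) ⟨
    x + suc (length ys)                      ∎
    where open ≡-Reasoning

perimeter-∷ : ∀ {x xs} → Decreasing (x ∷ xs) → perimeter (x ∷ xs) ≡ x + length xs
perimeter-∷ {x} {xs} (p ∷ _) = trans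
  (cong (λ l → l + suc (length xs) ∸ 1)
    (≤-antisym (max≤v⁺ z≤n (≤-refl ∷ p)) (All.head (xs≤max 0 (x ∷ xs)))))
  (cong (_∸ 1) (+-suc x (length xs)))

length-rimCells : ∀ {ps} → Decreasing ps → length (rimCells ps) ≡ perimeter ps
length-rimCells []       = refl
length-rimCells (p ∷ ps) = trans (length-rimCells-∷ (p ∷ ps)) (sym (perimeter-∷ (p ∷ ps)))

firstColumn>0 : ∀ {xs} → Positive xs → 0 < firstColumn xs
firstColumn>0 []      = s≤s z≤n
firstColumn>0 (p ∷ _) = p

≤firstColumn : ∀ {xs} → Decreasing xs → All (_≤ firstColumn xs) xs
≤firstColumn []      = []
≤firstColumn (p ∷ _) = ≤-refl ∷ p

firstColumn≤ : ∀ {m xs} → 0 < m → All (_≤ m) xs → firstColumn xs ≤ m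
firstColumn≤ 0<m []      = 0<m
firstColumn≤ _   (p ∷ _) = p

pushRow-isRimCell : ∀ {x xs c} → All (_≤ x) xs → IsRimCell xs c →
                    IsRimCell (x ∷ xs) (pushRow x c)
pushRow-isRimCell {c = [] , _} _ (mkIsRimCell _ ne _ _ _) = contradiction refl ne
pushRow-isRimCell {c = _ ∷ _ , _} (y≤x ∷ _) (mkIsRimCell refl _ m>0 (m≤y ∷ ins) nd) =
  mkIsRimCell refl (λ ()) m>0 (≤-trans m≤y y≤x ∷ m≤y ∷ ins) nd

rimCells-sound : ∀ {ps c} → Positive ps → Decreasing ps → c ∈ rimCells ps → IsRimCell ps c
rimCells-sound {x ∷ xs} (_ ∷ pos) (q ∷ dec) c∈ with ∈-++⁻ (topCells x xs) c∈
... | inj₁ c∈top with i , i∈ , refl ← ∈-map⁻ _ c∈top = mkIsRimCell refl (λ ())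
  (≤-trans (firstColumn>0 pos) (m≤m+n f i))
  (s≤s⁻¹ f+i<1+x ∷ [])
  (All.map (λ y≤ → ≤-trans y≤ (m≤m+n f i)) (≤firstColumn dec))
  where
  f = firstColumn xs
  f≤1+x : f ≤ suc x
  f≤1+x = firstColumn≤ (s≤s z≤n) (All.map m≤n⇒m≤1+n q)
  f+i<1+x : f + i < suc x
  f+i<1+x = ≤-trans (+-monoʳ-< f (∈-upTo⁻ i∈)) (≤-reflexive (m+[n∸m]≡n f≤1+x))
... | inj₂ c∈rest with _ , d∈ , refl ← ∈-map⁻ (pushRow x) c∈rest =
  pushRow-isRimCell q (rimCells-sound pos dec d∈)

rimCells-complete : ∀ {ps c} → IsRimCell ps c → c ∈ rimCells ps
rimCells-complete {c = [] , _} (mkIsRimCell _ ne _ _ _) = contradiction refl ne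
rimCells-complete {c = x ∷ [] , β , m} (mkIsRimCell refl _ m>0 (m≤x ∷ []) nd) =
  ∈-++⁺ˡ (subst (λ k → (x ∷ [] , β , k) ∈ topCells x β) (m+[n∸m]≡n f≤m)
    (∈-map⁺ _ (∈-upTo⁺ (∸-monoˡ-< (s≤s m≤x) f≤m))))
  where
  f≤m : firstColumn β ≤ m
  f≤m = firstColumn≤ m>0 nd
rimCells-complete {c = x ∷ α@(_ ∷ _) , β , m} (mkIsRimCell refl _ m>0 (_ ∷ ins) nd) =
  ∈-++⁺ʳ (topCells x (α ++ β))
    (∈-map⁺ (pushRow x) (rimCells-complete (mkIsRimCell refl (λ ()) m>0 ins nd)))

rimCells-unique : ∀ ps → Positive ps → Decreasing ps → Unique (rimCells ps)
rimCells-unique []       _         _         = []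
rimCells-unique (x ∷ xs) (_ ∷ pos) (_ ∷ dec) = Unique.++⁺
  (Unique.map⁺ (+-cancelˡ-≡ (firstColumn xs) _ _ ∘ cong (proj₂ ∘ proj₂)) (Unique.upTo⁺ _))
  (Unique.map⁺ pushRow-injective (rimCells-unique xs pos dec))
  disjoint
  where
  pushRow-injective : ∀ {c d} → pushRow x c ≡ pushRow x d → c ≡ d
  pushRow-injective refl = refl

  -- A cell below the first row has at least two rows down to its own.
  disjoint : ∀ {c} → c ∈ topCells x xs × c ∈ map (pushRow x) (rimCells xs) → _
  disjoint (c∈top , c∈rest)
    with _ , _ , refl ← ∈-map⁻ _ c∈top
    with d , d∈ , refl ← ∈-map⁻ (pushRow x) c∈rest
    = IsRimCell.nonempty (rimCells-sound pos dec d∈) refl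

-- Partitions with a chosen rim cell

-- The pairs of a partition of n and one of its rim cells.  The cell alone is
-- listed, since it determines the partition.
pointedPartitions : ℕ → List Cell
pointedPartitions n = concatMap rimCells (partitions n)

-- The rows of the cell form a partition of n, of which it is a rim cell.
IsPointed : ℕ → Cell → Set
IsPointed n c@(α , β , _) = IsPartition n (α ++ β) × IsRimCell (α ++ β) c

length-pointedPartitions : ∀ n →
  length (pointedPartitions n) ≡ sum (map perimeter (partitions n))
length-pointedPartitions n = go (partitions n) (All.tabulate (Equivalence.to (∈-partitions n _)))
  where
  go : ∀ pss → All (IsPartition n) pss →
       length (concatMap rimCells pss) ≡ sum (map perimeter pss)
  go []         []       = refl
  go (ps ∷ pss) (p ∷ qs) = trans (length-++ (rimCells ps))
    (cong₂ _+_ (length-rimCells (multiset⇒decreasing (IsPartition.multiset p))) (go pss qs))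

partition-rimCells-sound : ∀ {n ps c} → IsPartition n ps → c ∈ rimCells ps → IsRimCell ps c
partition-rimCells-sound (mkIsPartition mul pos _) = rimCells-sound pos (multiset⇒decreasing mul)

∈-pointedPartitions : ∀ n c → c ∈ pointedPartitions n ⇔ IsPointed n c
∈-pointedPartitions n c = mk⇔ sound complete
  where
  sound : c ∈ pointedPartitions n → IsPointed n c
  sound c∈ with _ , c∈ps , ps∈ ← ∈-concat⁻′ (map rimCells (partitions n)) c∈
    with ps , ps∈ , refl ← ∈-map⁻ rimCells ps∈
    with p ← Equivalence.to (∈-partitions n ps) ps∈
    with r@(mkIsRimCell refl _ _ _ _) ← partition-rimCells-sound p c∈ps = p , r

  complete : IsPointed n c → c ∈ pointedPartitions n
  complete (p , r) = ∈-concat⁺′ (rimCells-complete r)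
    (∈-map⁺ rimCells (Equivalence.from (∈-partitions n _) p))

pointedPartitions-unique : ∀ n → Unique (pointedPartitions n)
pointedPartitions-unique n =
  go (All.tabulate (Equivalence.to (∈-partitions n _))) (partitions-unique n)
  where
  go : ∀ {pss} → All (IsPartition n) pss → Unique pss → Unique (concatMap rimCells pss)
  go []       []       = []
  go {ps ∷ pss} (p@(mkIsPartition mul pos _) ∷ qs) (ps∉ ∷ u) =
    Unique.++⁺ (rimCells-unique ps pos (multiset⇒decreasing mul)) (go qs u) disjoint
    where
    disjoint : ∀ {c} → c ∈ rimCells ps × c ∈ concatMap rimCells pss → _
    disjoint (c∈ps , c∈pss)
      with _ , c∈qs , qs∈ ← ∈-concat⁻′ (map rimCells pss) c∈pss
      with rs , rs∈ , refl ← ∈-map⁻ rimCells qs∈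
      = All.lookup ps∉ rs∈ (trans
          (sym (IsRimCell.rows (partition-rimCells-sound p c∈ps)))
          (IsRimCell.rows (partition-rimCells-sound (All.lookup qs rs∈) c∈qs)))

-- The bijection

-- The diagram to the right of the rectangle by its rows, the rectangle by its
-- columns, each of which has as many cells as γ has parts, and the diagram
-- below it by its columns.
toCopartition : Cell → Triple
toCopartition (α , β , m) = map (_∸ m) α , replicate m (length α) , columns m β

fromCopartition : Triple → Cell
fromCopartition (γ , _ , σ) = map (length σ +_) γ , fromColumns σ , length σ

sum-map-∸ : ∀ {m α} → All (m ≤_) α → sum (map (_∸ m) α) + m * length α ≡ sum α
sum-map-∸ {m} []               = *-zeroʳ m
sum-map-∸ {m} {a ∷ α} (p ∷ ps) = begin
  a ∸ m + s + m * suc (length α)     ≡⟨ regroup (a ∸ m) s m (length α) ⟩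
  (a ∸ m + m) + (s + m * length α)   ≡⟨ cong₂ _+_ (m∸n+n≡m p) (sum-map-∸ ps) ⟩
  a + sum α                          ∎
  where
  open ≡-Reasoning
  s = sum (map (_∸ m) α)
  regroup : ∀ d s m l → d + s + m * suc l ≡ (d + m) + (s + m * l)
  regroup = solve-∀

map-∸-+ : ∀ m γ → map (_∸ m) (map (m +_) γ) ≡ γ
map-∸-+ m []      = refl
map-∸-+ m (g ∷ γ) = cong₂ _∷_ (m+n∸m≡n m g) (map-∸-+ m γ)

map-+-∸ : ∀ {m α} → All (m ≤_) α → map (m +_) (map (_∸ m) α) ≡ α
map-+-∸ []       = refl
map-+-∸ (p ∷ ps) = cong₂ _∷_ (m+[n∸m]≡n p) (map-+-∸ ps)

map-decreasing : ∀ {f xs} → (∀ {x y} → x ≤ y → f x ≤ f y) → Decreasing xs → Decreasing (map f xs)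
map-decreasing mono dec = AllPairs.map⁺ (AllPairs.map mono dec)

replicate-decreasing : ∀ m k → Decreasing (replicate m k)
replicate-decreasing zero    k = []
replicate-decreasing (suc m) k = All.replicate⁺ m ≤-refl ∷ replicate-decreasing m k

replicate-length : ∀ {k : ℕ} {xs : List ℕ} → All (_≡ k) xs → replicate (length xs) k ≡ xs
replicate-length []          = refl
replicate-length (refl ∷ ps) = cong (_ ∷_) (replicate-length ps)

Decreasing-++⁻ : ∀ α {β} → Decreasing (α ++ β) → Decreasing α × Decreasing β
Decreasing-++⁻ []      dec      = [] , dec
Decreasing-++⁻ (x ∷ α) (p ∷ ps) with dα , dβ ← Decreasing-++⁻ α ps = All.++⁻ˡ α p ∷ dα , dβ

Decreasing-++⁺ : ∀ {m α β} → Decreasing α → Decreasing β → All (m ≤_) α → All (_≤ m) β →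
                 Decreasing (α ++ β)
Decreasing-++⁺ dα dβ inα inβ =
  AllPairs.++⁺ dα dβ (All.map (λ m≤x → All.map (λ y≤m → ≤-trans y≤m m≤x) inβ) inα)

map≢[] : ∀ {f : ℕ → ℕ} {xs} → xs ≢ [] → map f xs ≢ []
map≢[] {xs = []}    ne _ = ne refl
map≢[] {xs = _ ∷ _} _  ()

length>0 : ∀ {xs : List ℕ} → xs ≢ [] → 0 < length xs
length>0 {[]}    ne = contradiction refl ne
length>0 {_ ∷ _} _  = s≤s z≤n

toCopartition-correct : ∀ {n c} → IsPointed n c →
                        IsCopartition (toCopartition c) × size (toCopartition c) ≡ n
toCopartition-correct {n} {α , β , m} (mkIsPartition mul pos refl , mkIsRimCell _ ne m>0 ins nd)
  with dα , dβ ← Decreasing-++⁻ α (multiset⇒decreasing mul) =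
    mkIsCopartition
      (AllPairs⇒Linked (map-decreasing (∸-monoˡ-≤ m) dα))
      (AllPairs⇒Linked (replicate-decreasing m (length α)))
      (AllPairs⇒Linked (columns-decreasing m β))
      (map≢[] ne)
      (λ eq → <⇒≢ m>0 (trans (cong length (sym eq)) (length-columns m β)))
      (trans (length-replicate m) (sym (length-columns m β)))
      (All.replicate⁺ m (sym (length-map (_∸ m) α)))
  , (begin
      sum γ + sum (replicate m (length α)) + sum (columns m β)
        ≡⟨ cong₂ (λ r s → sum γ + r + s) rect (sum-columns m (All.++⁻ʳ α pos) dβ nd) ⟩
      sum γ + m * length α + sum β
        ≡⟨ cong (_+ sum β) (sum-map-∸ ins) ⟩
      sum α + sum β
        ≡⟨ sum-++ α β ⟨
      sum (α ++ β) ∎)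
  where
  open ≡-Reasoning
  γ = map (_∸ m) α
  rect : sum (replicate m (length α)) ≡ m * length α
  rect = trans (sum-const (All.replicate⁺ m refl)) (cong (_* length α) (length-replicate m))

from-to : ∀ {n c} → IsPointed n c → fromCopartition (toCopartition c) ≡ c
from-to {n} {α , β , m} (mkIsPartition mul pos _ , mkIsRimCell _ _ _ ins nd)
  rewrite length-columns m β
  with _ , dβ ← Decreasing-++⁻ α (multiset⇒decreasing mul) =
  cong₂ (λ a b → a , b , m) (map-+-∸ ins) (fromColumns-columns m (All.++⁻ʳ α pos) dβ nd)

to-from : ∀ {t} → IsCopartition t → toCopartition (fromCopartition t) ≡ t
to-from {γ , ρ , σ} t =
  cong₂ _,_ (map-∸-+ (length σ) γ) (cong₂ _,_ rect (columns-fromColumns dσ))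
  where
  open IsCopartition t using (σ-multiset; ρ-length; ρ-parts)
  dσ = multiset⇒decreasing σ-multiset
  rect : replicate (length σ) (length (map (length σ +_) γ)) ≡ ρ
  rect = trans (cong₂ replicate (sym ρ-length) (length-map (length σ +_) γ))
    (replicate-length ρ-parts)

fromCopartition-correct : ∀ {n t} → IsCopartition t → size t ≡ n →
                          IsPointed n (fromCopartition t)
fromCopartition-correct {n} {γ , ρ , σ} t refl =
    mkIsPartition
      (AllPairs⇒Linked (Decreasing-++⁺ (map-decreasing (+-monoʳ-≤ m) dγ)
        (fromColumns-decreasing σ) ins (fromColumns-bounded σ)))
      (All.++⁺ (All.map (≤-trans m>0) ins) (fromColumns-positive σ))
      (begin
        sum (α ++ fromColumns σ)                ≡⟨ sum-++ α (fromColumns σ) ⟩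
        sum α + sum (fromColumns σ)             ≡⟨ cong₂ _+_ sumα (sum-fromColumns dσ) ⟩
        sum γ + sum ρ + sum σ                   ∎)
  , mkIsRimCell refl (map≢[] γ-nonempty) m>0 ins (fromColumns-bounded σ)
  where
  open IsCopartition t using (γ-multiset; σ-multiset; γ-nonempty; σ-nonempty; ρ-length; ρ-parts)
  open ≡-Reasoning
  m = length σ
  α = map (m +_) γ
  dγ = multiset⇒decreasing γ-multiset
  dσ = multiset⇒decreasing σ-multiset
  m>0 : 0 < m
  m>0 = length>0 σ-nonempty
  ins : All (m ≤_) α
  ins = All.map⁺ (All.universal (m≤m+n m) γ)
  sumα : sum α ≡ sum γ + sum ρ
  sumα = begin
    sum α                                       ≡⟨ sum-map-∸ ins ⟨
    sum (map (_∸ m) α) + m * length α           ≡⟨ cong₂ (λ g l → sum g + m * l)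
                                                     (map-∸-+ m γ) (length-map (m +_) γ) ⟩
    sum γ + m * length γ                        ≡⟨ cong (λ l → sum γ + l * length γ) ρ-length ⟨
    sum γ + length ρ * length γ                 ≡⟨ cong (sum γ +_) (sum-const ρ-parts) ⟨
    sum γ + sum ρ                               ∎

-- A map with a left inverse on the members of a list keeps them distinct.
map-unique : ∀ {A B : Set} {f : A → B} {g : B → A} {xs} →
             (∀ {x} → x ∈ xs → g (f x) ≡ x) → Unique xs → Unique (map f xs)
map-unique {f = f} {g} {xs} gf u = Unique.map⁻ (subst Unique (sym g∘f) u)
  where
  g∘f : map g (map f xs) ≡ xs
  g∘f = trans (sym (map-∘ xs)) (trans (map-cong-local (All.tabulate gf)) (map-id xs))

length-copartitions : ∀ n → length (copartitions n) ≡ length (pointedPartitions n)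
length-copartitions n = trans (sym (length-map fromCopartition (copartitions n)))
  (↭-length (∼bag⇒↭ (unique∧set⇒bag
    (map-unique {g = toCopartition} (to-from ∘ proj₁ ∘ Equivalence.to (∈-copartitions n _))
      (copartitions-unique n))
    (pointedPartitions-unique n)
    (λ {c} → mk⇔ sound complete))))
  where
  sound : ∀ {c} → c ∈ map fromCopartition (copartitions n) → c ∈ pointedPartitions n
  sound c∈ with t , t∈ , refl ← ∈-map⁻ fromCopartition c∈
    with p , eq ← Equivalence.to (∈-copartitions n t) t∈ =
    Equivalence.from (∈-pointedPartitions n _) (fromCopartition-correct p eq)

  complete : ∀ {c} → c ∈ pointedPartitions n → c ∈ map fromCopartition (copartitions n)
  complete {c} c∈ with p ← Equivalence.to (∈-pointedPartitions n c) c∈ =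
    subst (_∈ map fromCopartition (copartitions n)) (from-to p)
      (∈-map⁺ fromCopartition
        (Equivalence.from (∈-copartitions n (toCopartition c)) (toCopartition-correct p)))

theorem4p14 : ∀ (n : ℕ) → cp₀₀₁ n ≡ sum (map perimeter (partitions n))
theorem4p14 n = trans (length-copartitions n) (length-pointedPartitions n)
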